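{- For every integer $k \geq 1$, there are, up to isomorphism, only finitely many $k$-vertex-critical $(P_5,\text{cricket})$-free graphs.
   Context: All graphs are finite and simple. For graphs $G, F_1, F_2$, $G$ is $(F_1,F_2)$-free if neither $F_1$ nor $F_2$ is (isomorphic to) an induced subgraph of $G$. $\chi(G)$ denotes the chromatic number of $G$. A graph $G$ is $k$-vertex-critical if $\chi(G)=k$ but $\chi(G-v)<k$ for every vertex $v\in V(G)$. $P_5$ is the path on $5$ vertices. The cricket is the $5$-vertex graph obtained from a triangle by adding two pendant vertices (new vertices of degree one, nonadjacent to each other), both adjacent to the same vertex of the triangle. -}

module Defs where

open import Data.Bool.Base using (Bool; true; false; _∨_)
import Data.Bool.Properties as Bool
open import Data.Fin using (Fin; #_; punchIn)
open import Data.Fin.Properties using (_≟_; all?)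
open import Data.List.Base using (List; []; _∷_)
import Data.List.Membership.DecPropositional as DecMembership
open import Data.List.Relation.Unary.Any using (Any)
open import Data.Nat.Base using (ℕ; suc; pred; _<_)
open import Data.Product.Base using (∃; ∃-syntax; Σ-syntax; _×_; _,_; proj₂)
open import Data.Product.Properties using (≡-dec)
open import Function.Bundles using (_↔_; Inverse)
open import Function.Definitions using (Injective)
open import Relation.Binary.PropositionalEquality using (_≡_; _≢_)
open import Relation.Nullary using (¬_)
open import Relation.Nullary.Decidable using (⌊_⌋; from-yes)

record Graph (n : ℕ) : Set where
  field
    adj    : Fin n → Fin n → Bool
    sym    : ∀ u v → adj u v ≡ adj v u
    irrefl : ∀ v → adj v v ≡ false

open Graph public

infix 4 _≅_ _⊑_

_≅_ : ∀ {m n} → Graph m → Graph n → Set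
_≅_ {m} {n} G H =
  Σ[ f ∈ Fin m ↔ Fin n ]
    (∀ u v → adj G u v ≡ adj H (Inverse.to f u) (Inverse.to f v))

-- H ⊑ G: H is isomorphic to an induced subgraph of G.
_⊑_ : ∀ {m n} → Graph m → Graph n → Set
_⊑_ {m} {n} H G =
  Σ[ f ∈ (Fin m → Fin n) ]
    Injective _≡_ _≡_ f × (∀ u v → adj H u v ≡ adj G (f u) (f v))

_,_-Free : ∀ {m₁ m₂ n} → Graph m₁ → Graph m₂ → Graph n → Set
(F₁ , F₂ -Free) G = ¬ F₁ ⊑ G × ¬ F₂ ⊑ G

-- punchIn v enumerates, in order, the vertices different from v.
delete : ∀ {n} → Graph n → Fin n → Graph (pred n)
delete {suc n} G v = record
  { adj    = λ x y → adj G (punchIn v x) (punchIn v y)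
  ; sym    = λ x y → sym G (punchIn v x) (punchIn v y)
  ; irrefl = λ x → irrefl G (punchIn v x)
  }

Colourable : ∀ {n} → Graph n → ℕ → Set
Colourable {n} G k =
  Σ[ c ∈ (Fin n → Fin k) ] (∀ u v → adj G u v ≡ true → c u ≢ c v)

-- The chromatic number, as a functional relation: χ G ≐ k reads χ(G) = k.
infix 4 χ_≐_

χ_≐_ : ∀ {n} → Graph n → ℕ → Set
χ G ≐ k = Colourable G k × (∀ j → j < k → ¬ Colourable G j)

VertexCritical : ∀ {n} → ℕ → Graph n → Set
VertexCritical k G =
  (χ G ≐ k) × (∀ v → ∃[ j ] (χ delete G v ≐ j) × j < k)

-- Every graph satisfying P is isomorphic to an entry of one finite list.
FinitelyManyUpToIso : (∀ {n} → Graph n → Set) → Set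
FinitelyManyUpToIso P =
  Σ[ Hs ∈ List (∃ Graph) ]
    (∀ {n} (G : Graph n) → P G → Any (λ H → G ≅ proj₂ H) Hs)

module _ {n : ℕ} where
  open DecMembership (≡-dec (_≟_ {n}) (_≟_ {n})) using (_∈?_)

  edge : List (Fin n × Fin n) → Fin n → Fin n → Bool
  edge es u v = ⌊ (u , v) ∈? es ⌋ ∨ ⌊ (v , u) ∈? es ⌋

  fromEdges : (es : List (Fin n × Fin n)) → (∀ v → edge es v v ≡ false) → Graph n
  fromEdges es loopless = record
    { adj    = edge es
    ; sym    = λ u v → Bool.∨-comm ⌊ (u , v) ∈? es ⌋ ⌊ (v , u) ∈? es ⌋
    ; irrefl = loopless
    }

P₅ : Graph 5
P₅ = fromEdges es (from-yes (all? λ v → edge es v v Bool.≟ false))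
  where
  es : List (Fin 5 × Fin 5)
  es = (# 0 , # 1) ∷ (# 1 , # 2) ∷ (# 2 , # 3) ∷ (# 3 , # 4) ∷ []

-- Triangle 0 1 2, with pendant vertices 3 and 4 attached to 0.
cricket : Graph 5
cricket = fromEdges es (from-yes (all? λ v → edge es v v Bool.≟ false))
  where
  es : List (Fin 5 × Fin 5)
  es = (# 0 , # 1) ∷ (# 1 , # 2) ∷ (# 0 , # 2) ∷ (# 0 , # 3) ∷ (# 0 , # 4) ∷ []

-- Suppose v is complete to a large independent set S. By criticality each s ∈ S
-- has a neighbour missing many vertices of S, and in a cricket-free graph such a
-- vertex is not adjacent to v. Taking u with as many neighbours in S as possible,
-- P₅-freeness yields y ~ u such that u and y split S into N(u) ∩ S and N(y) ∩ S.
-- The part S ∖ N(u) is still large, so it is split again, by w ~ z say; the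
-- adjacencies between u, y and w, z then force a P₅ or a cricket. Hence independent
-- sets in neighbourhoods are bounded, and so are the degrees, the graph being
-- k-colourable. Finally a ball of radius 3 is the whole graph: P₅-freeness makes it
-- closed under adjacency, and a critical graph is connected.
module Submission where

open import Defs
open import Data.Nat.Base using (ℕ; _≥_)
open import Data.Product.Base using (_×_)

open import Data.Bool.Base using (Bool; true; false)
import Data.Bool.Properties as Bool
open import Data.Empty using (⊥)
open import Data.Fin.Base using (Fin; zero; suc; toℕ; fromℕ<; punchOut)
open import Data.Fin.Patterns using (3F; 4F)
import Data.Fin.Properties as Fin
open import Data.List.Base
  using (List; []; _∷_; length; filter; map; concatMap; allFin; upTo; cartesianProductWith)
import Data.List.Membership.DecPropositional as DecMembership
open import Data.List.Membership.Propositional using (_∈_; _∉_; find; lose)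
open import Data.List.Membership.Propositional.Properties
  using (∈-filter⁺; ∈-filter⁻; ∈-allFin; ∈-upTo⁺; ∈-concatMap⁺; ∈-concatMap⁻; ∈-cartesianProductWith⁺)
import Data.List.Membership.Setoid.Properties as SetoidMembership
import Data.List.Properties as List
open import Data.List.Relation.Binary.Sublist.Propositional using (⊆-refl)
open import Data.List.Relation.Binary.Sublist.Propositional.Properties
  using (length-mono-≤; filter-⊆)
  renaming (filter⁺ to filter⁺-⊆)
open import Data.List.Relation.Unary.All as All using (All; _∷_)
open import Data.List.Relation.Unary.All.Properties
  using (all-filter) renaming (filter⁺ to All-filter⁺)
open import Data.List.Relation.Unary.AllPairs using (_∷_)
open import Data.List.Relation.Unary.Any as Any using (here; there; any?)
import Data.List.Relation.Unary.Any.Properties as Any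
open import Data.List.Relation.Unary.Unique.Propositional using (Unique)
open import Data.List.Relation.Unary.Unique.Propositional.Properties
  using () renaming (filter⁺ to Unique-filter⁺; allFin⁺ to Unique-allFin)
open import Data.Nat.Base using (zero; suc; _+_; _*_; _^_; _≤_; _<_; z≤n; s≤s; s≤s⁻¹)
open import Data.Nat.Properties
open import Data.Product.Base using (Σ-syntax; ∃; ∃₂; ∃-syntax; _,_; proj₁; proj₂)
open import Data.Sum.Base using (_⊎_; inj₁; inj₂; [_,_]′)
open import Data.Unit.Base using (⊤)
open import Data.Vec.Base using (Vec; []; _∷_; tabulate; lookup)
import Data.Vec.Properties as Vec
open import Data.Vec.Relation.Binary.Pointwise.Inductive as Pointwise using (Pointwise; []; _∷_)
open import Function.Base using (_∘_)
open import Function.Construct.Identity using (↔-id)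
open import Function.Definitions using (Injective)
open import Relation.Binary.PropositionalEquality as ≡ using (_≡_; _≢_; refl; trans; cong; subst)
open import Relation.Nullary using (Dec; ¬_; yes; no; contradiction)
open import Relation.Nullary.Decidable using (_×-dec_; _⊎-dec_; _→-dec_; ¬?; from-yes)
open import Relation.Unary using (Decidable)

-- Pigeonhole and counting in lists.

length-filter-split : ∀ {A : Set} {P : A → Set} (P? : Decidable P) xs →
  length (filter P? xs) + length (filter (¬? ∘ P?) xs) ≡ length xs
length-filter-split P? []       = refl
length-filter-split P? (x ∷ xs) with P? x
... | yes _ = cong suc (length-filter-split P? xs)
... | no _  = trans (+-suc _ _) (cong suc (length-filter-split P? xs))

-- Induction on the number of colours: if the last colour occurs at most `m` times, dropping it
-- leaves more than `j * m` elements for the other `j` colours.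
monochromatic : ∀ {A : Set} (c : A → ℕ) m j xs → All (λ x → c x < j) xs → j * m < length xs →
  ∃[ i ] i < j × m < length (filter (λ x → c x ≟ i) xs)
monochromatic c m zero    (x ∷ xs) (() ∷ _) _
monochromatic c m (suc j) xs c< large with m <? length (filter (λ x → c x ≟ j) xs)
... | yes many = j , n<1+n j , many
... | no few   =
  let i , i<j , many = monochromatic c m j rest rest< rest-large in
  i , m<n⇒m<1+n i<j ,
  <-≤-trans many (length-mono-≤
    (filter⁺-⊆ (λ x → c x ≟ i) (λ x → c x ≟ i) (λ { refl p → p }) (filter-⊆ _ xs)))
  where
  last? : Decidable (λ x → c x ≡ j)
  last? x = c x ≟ j
  rest = filter (¬? ∘ last?) xs
  rest< : All (λ x → c x < j) rest
  rest< = All.zipWith (λ (c<1+j , c≢j) → ≤∧≢⇒< (s≤s⁻¹ c<1+j) c≢j)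
    (All-filter⁺ (¬? ∘ last?) c< , all-filter (¬? ∘ last?) xs)
  rest-large : j * m < length rest
  rest-large = +-cancelˡ-< m _ _ (<-≤-trans large (≤-trans
    (≤-reflexive (≡.sym (length-filter-split last? xs)))
    (+-monoˡ-≤ (length rest) (≮⇒≥ few))))

two-distinct : ∀ {A : Set} {xs : List A} → Unique xs → 1 < length xs →
  ∃₂ λ p q → p ∈ xs × q ∈ xs × p ≢ q
two-distinct {xs = p ∷ q ∷ _} ((p≢q ∷ _) ∷ _) _ = p , q , here refl , there (here refl) , p≢q
two-distinct {xs = _ ∷ []}    _ (s≤s ())

∈-nonempty : ∀ {A : Set} {xs : List A} → 0 < length xs → ∃ (_∈ xs)
∈-nonempty {xs = x ∷ _} _ = x , here refl

length-concatMap-≤ : ∀ {A B : Set} {f : A → List B} {d} → (∀ x → length (f x) ≤ d) →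
  ∀ xs → length (concatMap f xs) ≤ length xs * d
length-concatMap-≤ f≤ []       = z≤n
length-concatMap-≤ {f = f} f≤ (x ∷ xs) =
  ≤-trans (≤-reflexive (List.length-++ (f x))) (+-mono-≤ (f≤ x) (length-concatMap-≤ f≤ xs))

-- Otherwise the position of each element in `xs` would inject `Fin n` into fewer than `n` indices.
∉-exists : ∀ {n} (xs : List (Fin n)) → length xs < n → ∃ (_∉ xs)
∉-exists {n} xs short with Fin.any? (λ x → ¬? (DecMembership._∈?_ Fin._≟_ x xs))
... | yes missing = missing
... | no  none    = contradiction (Fin.injective⇒≤ index-inj) (<⇒≱ short)
  where
  all∈ : ∀ x → x ∈ xs
  all∈ x with DecMembership._∈?_ Fin._≟_ x xs
  ... | yes x∈ = x∈
  ... | no x∉  = contradiction (x , x∉) none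
  index-inj : Injective _≡_ _≡_ (λ x → Any.index (all∈ x))
  index-inj {x} {y} = SetoidMembership.index-injective (≡.setoid (Fin n)) (all∈ x) (all∈ y)

-- Proper colourings and deleted vertices.

Proper : ∀ {n} → Graph n → (Fin n → ℕ) → Set
Proper G c = ∀ u w → adj G u w ≡ true → c u ≢ c w

proper⇒colourable : ∀ {n k} (G : Graph n) (c : Fin n → ℕ) → Proper G c → (∀ w → c w < k) →
  Colourable G k
proper⇒colourable G c proper c< =
  (λ w → fromℕ< (c< w)) ,
  λ u w u~w eq → proper u w u~w (Fin.fromℕ<-injective _ _ (c< u) (c< w) eq)

-- The colour `k` is fresh, so no edge at `s` becomes monochromatic. Colours are naturals so that
-- this one vertex can exceed the bound that holds elsewhere.
extend-colouring : ∀ {n j k} (G : Graph n) (s : Fin n) → j ≤ k → Colourable (delete G s) j →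
  Σ[ c ∈ (Fin n → ℕ) ] Proper G c × (∀ w → w ≢ s → c w < k) × c s ≡ k
extend-colouring {suc n} {j} {k} G s j≤k (f , f-proper) = c , proper , c< , c-s
  where
  c : Fin (suc n) → ℕ
  c w with s Fin.≟ w
  ... | yes _  = k
  ... | no s≢w = toℕ (f (punchOut s≢w))
  c< : ∀ w → w ≢ s → c w < k
  c< w w≢s with s Fin.≟ w
  ... | yes s≡w = contradiction (≡.sym s≡w) w≢s
  ... | no s≢w  = <-≤-trans (Fin.toℕ<n _) j≤k
  c-s : c s ≡ k
  c-s with s Fin.≟ s
  ... | yes _  = refl
  ... | no s≢s = contradiction refl s≢s
  proper : Proper G c
  proper u w u~w eq with s Fin.≟ u | s Fin.≟ w
  ... | yes refl | yes refl = contradiction (trans (≡.sym u~w) (irrefl G u)) λ ()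
  ... | yes refl | no s≢w   = <-irrefl (≡.sym eq) (<-≤-trans (Fin.toℕ<n (f (punchOut s≢w))) j≤k)
  ... | no s≢u   | yes refl = <-irrefl eq (<-≤-trans (Fin.toℕ<n (f (punchOut s≢u))) j≤k)
  ... | no s≢u   | no s≢w   = f-proper (punchOut s≢u) (punchOut s≢w)
    (trans (≡.cong₂ (adj G) (Fin.punchIn-punchOut s≢u) (Fin.punchIn-punchOut s≢w)) u~w)
    (Fin.toℕ-injective eq)

-- Adjacency and induced copies of small graphs.

module _ {n : ℕ} (G : Graph n) where

  infix 4 _~_ _≁_
  _~_ _≁_ : Fin n → Fin n → Set
  u ~ v = adj G u v ≡ true
  u ≁ v = adj G u v ≡ false

  adj? : ∀ u v → (u ~ v) ⊎ (u ≁ v)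
  adj? u v with adj G u v
  ... | true  = inj₁ refl
  ... | false = inj₂ refl

  swap : ∀ {u v b} → adj G u v ≡ b → adj G v u ≡ b
  swap {u} {v} = trans (sym G v u)

  conflict : ∀ {A : Set} {u v} → u ~ v → u ≁ v → A
  conflict e ¬e = contradiction (trans (≡.sym e) ¬e) λ ()

  -- Only the entries above the diagonal are recorded, row by row; symmetry and irreflexivity supply
  -- the others. For a concrete `H` this unfolds to a tuple of adjacencies and non-adjacencies.
  Copy : ∀ {m} → Graph m → Vec (Fin n) m → Set
  Copy H []       = ⊤
  Copy H (x ∷ xs) =
    Pointwise (λ b y → adj G x y ≡ b) (tabulate (λ i → adj H zero (suc i))) xs × Copy (delete H zero) xs

  copy-adj : ∀ {m} (H : Graph m) {xs} → Copy H xs →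
    ∀ i j → adj H i j ≡ adj G (lookup xs i) (lookup xs j)
  copy-adj H {x ∷ xs} (row , rest) zero    zero    = trans (irrefl H zero) (≡.sym (irrefl G x))
  copy-adj H {x ∷ xs} (row , rest) zero    (suc j) =
    ≡.sym (trans (Pointwise.lookup row j) (Vec.lookup∘tabulate _ j))
  copy-adj H {x ∷ xs} (row , rest) (suc i) zero    =
    trans (sym H (suc i) zero)
      (trans (≡.sym (trans (Pointwise.lookup row i) (Vec.lookup∘tabulate _ i))) (sym G x _))
  copy-adj H {x ∷ xs} (row , rest) (suc i) (suc j) = copy-adj (delete H zero) rest i j

  -- Positions holding the same vertex have identical rows, so a repetition can only occur between
  -- twins of `H`.
  copy-twins : ∀ {m} (H : Graph m) {xs} → Copy H xs →
    ∀ {i j} → lookup xs i ≡ lookup xs j → ∀ l → adj H i l ≡ adj H j l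
  copy-twins H {xs} copy {i} {j} eq l =
    trans (copy-adj H copy i l) (trans (cong (λ x → adj G x (lookup xs l)) eq) (≡.sym (copy-adj H copy j l)))

  -- No two vertices of `P₅` have the same neighbourhood, so the adjacencies alone force five
  -- distinct vertices.
  P₅-copy : ∀ {xs} → Copy P₅ xs → P₅ ⊑ G
  P₅-copy {xs} copy = lookup xs , (λ eq → twin-free _ _ (copy-twins P₅ copy eq)) , copy-adj P₅ copy
    where
    twin-free : ∀ i j → (∀ l → adj P₅ i l ≡ adj P₅ j l) → i ≡ j
    twin-free = from-yes (Fin.all? λ i → Fin.all? λ j →
      Fin.all? (λ l → adj P₅ i l Bool.≟ adj P₅ j l) →-dec (i Fin.≟ j))

  -- The pendant vertices are the only twins of the cricket; all other distinctness follows from the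
  -- adjacencies.
  cricket-copy : ∀ {xs} → Copy cricket xs → lookup xs 3F ≢ lookup xs 4F → cricket ⊑ G
  cricket-copy {xs} copy p≢q = lookup xs , injective , copy-adj cricket copy
    where
    twins : ∀ i j → (∀ l → adj cricket i l ≡ adj cricket j l) →
      i ≡ j ⊎ (i ≡ 3F × j ≡ 4F ⊎ i ≡ 4F × j ≡ 3F)
    twins = from-yes (Fin.all? λ i → Fin.all? λ j →
      Fin.all? (λ l → adj cricket i l Bool.≟ adj cricket j l) →-dec
      (i Fin.≟ j ⊎-dec (i Fin.≟ 3F ×-dec j Fin.≟ 4F ⊎-dec i Fin.≟ 4F ×-dec j Fin.≟ 3F)))
    injective : Injective _≡_ _≡_ (lookup xs)
    injective {i} {j} eq with twins i j (copy-twins cricket copy eq)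
    ... | inj₁ i≡j                  = i≡j
    ... | inj₂ (inj₁ (refl , refl)) = contradiction eq p≢q
    ... | inj₂ (inj₂ (refl , refl)) = contradiction (≡.sym eq) p≢q

  -- Independent sets, balls and missed vertices.

  Independent : List (Fin n) → Set
  Independent S = ∀ {x y} → x ∈ S → y ∈ S → x ≁ y

  nbrs : Fin n → List (Fin n)
  nbrs v = filter (λ x → adj G v x Bool.≟ true) (allFin n)

  -- Vertices may be listed repeatedly; the length is only ever bounded from above.
  ball : ℕ → Fin n → List (Fin n)
  ball zero    v = v ∷ []
  ball (suc r) v = concatMap (λ x → x ∷ nbrs x) (ball r v)

  ball-suc⁻ : ∀ {r v x} → x ∈ ball (suc r) v → ∃[ y ] y ∈ ball r v × (x ≡ y ⊎ y ~ x)
  ball-suc⁻ {r} {v} x∈ with find (∈-concatMap⁻ (λ x → x ∷ nbrs x) {xs = ball r v} x∈)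
  ... | y , y∈ , here x≡y = y , y∈ , inj₁ x≡y
  ... | y , y∈ , there x∈nbrs =
    y , y∈ , inj₂ (proj₂ (∈-filter⁻ (λ x → adj G y x Bool.≟ true) {xs = allFin n} x∈nbrs))

  ball-mono : ∀ {r v x} → x ∈ ball r v → x ∈ ball (suc r) v
  ball-mono x∈ = ∈-concatMap⁺ (λ x → x ∷ nbrs x) (lose x∈ (here refl))

  ball-nbr : ∀ {r v x y} → x ∈ ball r v → x ~ y → y ∈ ball (suc r) v
  ball-nbr {x = x} {y} x∈ x~y = ∈-concatMap⁺ (λ x → x ∷ nbrs x)
    (lose x∈ (there (∈-filter⁺ (λ y → adj G x y Bool.≟ true) (∈-allFin y) x~y)))

  length-ball-≤ : ∀ {d} → (∀ x → length (nbrs x) ≤ d) → ∀ r v → length (ball r v) ≤ suc d ^ r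
  length-ball-≤ nbrs≤ zero    v = s≤s z≤n
  length-ball-≤ {d} nbrs≤ (suc r) v = ≤-trans (length-concatMap-≤ (s≤s ∘ nbrs≤) (ball r v))
    (≤-trans (*-monoˡ-≤ (suc d) (length-ball-≤ nbrs≤ r v)) (≤-reflexive (*-comm (suc d ^ r) (suc d))))

  missed : Fin n → List (Fin n) → List (Fin n)
  missed u S = filter (λ x → adj G u x Bool.≟ false) S

  ∈-missed⁻ : ∀ {u x S} → x ∈ missed u S → x ∈ S × u ≁ x
  ∈-missed⁻ = ∈-filter⁻ (λ x → _ Bool.≟ false)

  Unique-missed : ∀ {S} u → Unique S → Unique (missed u S)
  Unique-missed u = Unique-filter⁺ (λ x → adj G u x Bool.≟ false)

  two-missed : ∀ {S} u → Unique S → 1 < length (missed u S) →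
    ∃₂ λ p q → (p ∈ S × u ≁ p) × (q ∈ S × u ≁ q) × p ≢ q
  two-missed u uniq many =
    let p , q , p∈ , q∈ , p≢q = two-distinct (Unique-missed u uniq) many
    in  p , q , ∈-missed⁻ p∈ , ∈-missed⁻ q∈ , p≢q

  colour-class-independent : ∀ {c} → Proper G c → ∀ {u w} → c u ≡ c w → u ≁ w
  colour-class-independent proper {u} {w} eq with adj? u w
  ... | inj₁ u~w = contradiction eq (proper u w u~w)
  ... | inj₂ u≁w = u≁w

  -- Forbidden configurations and splits.

  module Free (free : (P₅ , cricket -Free) G) where

    no-P₅ : ∀ {a b c d e} → a ~ b → b ~ c → c ~ d → d ~ e →
      a ≁ c → a ≁ d → a ≁ e → b ≁ d → b ≁ e → c ≁ e → ⊥
    no-P₅ {a} {b} {c} {d} {e} ab bc cd de ac ad ae bd be ce =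
      proj₁ free (P₅-copy {a ∷ b ∷ c ∷ d ∷ e ∷ []}
        ( (ab ∷ ac ∷ ad ∷ ae ∷ []) , (bc ∷ bd ∷ be ∷ []) , (cd ∷ ce ∷ []) , (de ∷ []) , [] , _))

    no-cricket : ∀ {c a b p q} → c ~ a → c ~ b → a ~ b → c ~ p → c ~ q →
      a ≁ p → a ≁ q → b ≁ p → b ≁ q → p ≁ q → p ≢ q → ⊥
    no-cricket {c} {a} {b} {p} {q} ca cb ab cp cq ap aq bp bq pq p≢q =
      proj₂ free (cricket-copy {c ∷ a ∷ b ∷ p ∷ q ∷ []}
        ( (ca ∷ cb ∷ cp ∷ cq ∷ []) , (ab ∷ ap ∷ aq ∷ []) , (bp ∷ bq ∷ []) , (pq ∷ []) , [] , _) p≢q)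

    -- The neighbourhoods of `u` and `y` partition `S`. What one end misses is exactly what the
    -- other sees, so the last two fields bound both parts from below.
    record Split (m : ℕ) (S : List (Fin n)) (v u y : Fin n) : Set where
      field
        u~y : u ~ y
        u≁v : u ≁ v
        y≁v : y ≁ v
        either : ∀ {x} → x ∈ S → u ≁ x → y ~ x
        not-both : ∀ {x} → x ∈ S → u ~ x → y ≁ x
        u-misses : m < length (missed u S)
        y-misses : m < length (missed y S)

    swap-split : ∀ {m S v u y} → Split m S v u y → Split m S v y u
    swap-split {S = S} {u = u} {y} σ = record
      { u~y = swap u~y ; u≁v = y≁v ; y≁v = u≁v ; either = either′ ; not-both = not-both′
      ; u-misses = y-misses ; y-misses = u-misses }
      where
      open Split σ
      either′ : ∀ {x} → x ∈ S → y ≁ x → u ~ x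
      either′ {x} x∈S y≁x with adj? u x
      ... | inj₁ u~x = u~x
      ... | inj₂ u≁x = conflict (either x∈S u≁x) y≁x
      not-both′ : ∀ {x} → x ∈ S → y ~ x → u ≁ x
      not-both′ {x} x∈S y~x with adj? u x
      ... | inj₁ u~x = conflict y~x (not-both x∈S u~x)
      ... | inj₂ u≁x = u≁x

    -- Recolouring in a vertex-critical graph.

    module _ {k} (critical : VertexCritical (suc k) G) where

      colouring-off : ∀ s → Σ[ c ∈ (Fin n → ℕ) ] Proper G c × (∀ w → w ≢ s → c w < k) × c s ≡ k
      colouring-off s =
        let j , (colourable , _) , j<1+k = proj₂ critical s
        in  extend-colouring G s (s≤s⁻¹ j<1+k) colourable

      not-k-colourable : ∀ c → Proper G c → ¬ (∀ w → c w < k)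
      not-k-colourable c proper c< =
        proj₂ (proj₁ critical) k (n<1+n k) (proper⇒colourable G c proper c<)

      -- Otherwise s could be recoloured with a colour that is frequent in S.
      nbr-missing-many : ∀ s {m S} → Unique S → 1 ≤ m → suc k * m < length S →
        ∃[ u ] u ~ s × m < length (missed u S)
      nbr-missing-many s {m} {S} uniq 1≤m large
        with Fin.any? (λ u → (adj G u s Bool.≟ true) ×-dec (m <? length (missed u S)))
      ... | yes found = found
      ... | no none with colouring-off s
      ...   | c , proper , c< , cs≡k =
        contradiction recoloured< (not-k-colourable recoloured recoloured-proper)
        where
        c≤ : ∀ w → c w < suc k
        c≤ w with w Fin.≟ s
        ... | yes refl = s≤s (≤-reflexive cs≡k)
        ... | no w≢s   = m<n⇒m<1+n (c< w w≢s)

        only-s : ∀ {w} → c w ≡ k → w ≡ s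
        only-s {w} cw≡k with w Fin.≟ s
        ... | yes w≡s = w≡s
        ... | no w≢s  = contradiction cw≡k (<⇒≢ (c< w w≢s))

        frequent = monochromatic c m (suc k) S (All.tabulate (λ {x} _ → c≤ x)) large
        i = proj₁ frequent
        class = filter (λ x → c x ≟ i) S
        m<class : m < length class
        m<class = proj₂ (proj₂ frequent)

        -- Colour `k` occurs at `s` only, whereas the class has at least two members because
        -- `1 ≤ m`.
        i<k : i < k
        i<k = ≤∧≢⇒< (s≤s⁻¹ (proj₁ (proj₂ frequent))) λ i≡k →
          let p , q , p∈ , q∈ , p≢q = two-distinct (Unique-filter⁺ (λ x → c x ≟ i) uniq) (≤-<-trans 1≤m m<class)
              is-s : ∀ {x} → x ∈ class → x ≡ s
              is-s x∈ = only-s (trans (proj₂ (∈-filter⁻ (λ x → c x ≟ i) {xs = S} x∈)) i≡k)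
          in  p≢q (trans (is-s p∈) (≡.sym (is-s q∈)))

        -- A neighbour of `s` with colour `i` would miss the whole class, hence more than `m`
        -- vertices of `S`, contrary to `none`.
        nbr-colour : ∀ {u} → u ~ s → c u ≢ i
        nbr-colour {u} u~s cu≡i = none (u , u~s , <-≤-trans m<class (length-mono-≤
          (filter⁺-⊆ (λ x → c x ≟ i) (λ x → adj G u x Bool.≟ false)
            (λ { refl cx≡i → colour-class-independent proper (trans cu≡i (≡.sym cx≡i)) }) (⊆-refl {x = S}))))

        recoloured : Fin n → ℕ
        recoloured w with w Fin.≟ s
        ... | yes _ = i
        ... | no _  = c w

        recoloured< : ∀ w → recoloured w < k
        recoloured< w with w Fin.≟ s
        ... | yes _  = i<k
        ... | no w≢s = c< w w≢s

        recoloured-proper : Proper G recoloured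
        recoloured-proper u w u~w with u Fin.≟ s | w Fin.≟ s
        ... | yes refl | yes refl = conflict u~w (irrefl G u)
        ... | yes refl | no _     = nbr-colour (swap u~w) ∘ ≡.sym
        ... | no _     | yes refl = nbr-colour u~w
        ... | no _     | no _     = proper u w u~w

      -- Splitting an independent set inside a neighbourhood.

      module _ {S : List (Fin n)} {v : Fin n} (uniq : Unique S) (indep : Independent S)
               (v~S : ∀ {x} → x ∈ S → v ~ x) where

        -- If `u ~ v`, then `v`, `s`, `u` form a triangle, and two vertices of `S` missed by `u` are
        -- pendant at `v`: a cricket.
        misses-centre : ∀ {u s} → s ∈ S → u ~ s → 1 < length (missed u S) → u ≁ v
        misses-centre {u} {s} s∈S u~s many with adj? u v
        ... | inj₂ u≁v = u≁v
        ... | inj₁ u~v with two-missed u uniq many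
        ...   | p , q , (p∈ , u≁p) , (q∈ , u≁q) , p≢q =
          contradiction p≢q (no-cricket (swap u~v) (v~S s∈S) u~s (v~S p∈) (v~S q∈)
            u≁p u≁q (indep s∈S p∈) (indep s∈S q∈) (indep p∈ q∈))

        module _ {m} (1≤m : 1 ≤ m) (large : suc k * m < length S) where

          -- If N(u) ∩ S ⊆ N(y) then y replaces u; W ⊇ S ∖ N(u) shrinks each time.
          split-from : ∀ d W → length W < d → ∀ {u s} → s ∈ S → u ~ s → m < length (missed u S) →
            (∀ {x} → x ∈ S → u ≁ x → x ∈ W) → ∃₂ (Split m S v)
          split-from (suc d) W W<d {u} {s} s∈S u~s many missed⊆W =
            step (two-missed u uniq (≤-<-trans 1≤m many))
            where
            u≁v = misses-centre s∈S u~s (≤-<-trans 1≤m many)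
            step : (∃₂ λ p q → (p ∈ S × u ≁ p) × (q ∈ S × u ≁ q) × p ≢ q) → ∃₂ (Split m S v)
            step (p , q , (p∈ , u≁p) , (q∈ , u≁q) , p≢q) with nbr-missing-many p uniq 1≤m large
            ... | y , y~p , y-many
              with any? (λ x → (adj G u x Bool.≟ true) ×-dec (adj G y x Bool.≟ false)) S
            -- Here `y` sees all that `u` sees in `S`, and `p` as well, so `p` drops out of the
            -- tracked list.
            ...   | no none = split-from d (missed y W) shorter p∈ y~p y-many
              λ x∈S y≁x → ∈-filter⁺ (λ x → adj G y x Bool.≟ false) (missed⊆W x∈S (u≁x x∈S y≁x)) y≁x
              where
              u≁x : ∀ {x} → x ∈ S → y ≁ x → u ≁ x
              u≁x {x} x∈S y≁x with adj? u x
              ... | inj₁ u~x = contradiction (lose x∈S (u~x , y≁x)) none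
              ... | inj₂ u≁x = u≁x
              shorter : length (missed y W) < d
              shorter = <-≤-trans (List.filter-notAll (λ x → adj G y x Bool.≟ false) W
                (lose (missed⊆W p∈ u≁p) (conflict y~p))) (s≤s⁻¹ W<d)
            ...   | yes found with find found
            -- Now `u` alone sees `s′` and `y` alone sees `p`. If `u` and `y` were nonadjacent,
            -- `u s′ v p y` would be an induced path. A vertex `x` of `S` missed by both gives the
            -- path `y u s′ v x`; one seen by both gives the triangle `y u x` with `p` and `q`
            -- pendant at `y`.
            ...     | s′ , s′∈S , u~s′ , y≁s′ = u , y , record
              { u~y = u~y ; u≁v = u≁v ; y≁v = y≁v ; either = either ; not-both = not-both
              ; u-misses = many ; y-misses = y-many }
              where
              y≁v = misses-centre p∈ y~p (≤-<-trans 1≤m y-many)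
              u~y : u ~ y
              u~y with adj? u y
              ... | inj₁ u~y = u~y
              ... | inj₂ u≁y = contradiction
                (no-P₅ u~s′ (swap (v~S s′∈S)) (v~S p∈) (swap y~p)
                  u≁v u≁p u≁y (indep s′∈S p∈) (swap y≁s′) (swap y≁v)) λ ()
              either : ∀ {x} → x ∈ S → u ≁ x → y ~ x
              either {x} x∈S u≁x with adj? y x
              ... | inj₁ y~x = y~x
              ... | inj₂ y≁x = contradiction
                (no-P₅ (swap u~y) u~s′ (swap (v~S s′∈S)) (v~S x∈S)
                  y≁s′ y≁v y≁x u≁v u≁x (indep s′∈S x∈S)) λ ()
              not-both : ∀ {x} → x ∈ S → u ~ x → y ≁ x
              not-both {x} x∈S u~x with adj? y x
              ... | inj₂ y≁x = y≁x
              ... | inj₁ y~x = contradiction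
                (no-cricket (swap u~y) y~x u~x (either p∈ u≁p) (either q∈ u≁q)
                  u≁p u≁q (indep x∈S p∈) (indep x∈S q∈) (indep p∈ q∈) p≢q) λ ()

          split : ∃₂ (Split m S v)
          split with ∈-nonempty (≤-<-trans z≤n large)
          ... | s , s∈S with nbr-missing-many s uniq 1≤m large
          ...   | u , u~s , many = split-from (suc (length S)) S ≤-refl s∈S u~s many λ x∈S _ → x∈S

      -- Excluding a second split, and the degree bound.

      module _ {S : List (Fin n)} {v : Fin n} (uniq : Unique S) (indep : Independent S)
               (v~S : ∀ {x} → x ∈ S → v ~ x) where

        module _ {m u y} (σ : Split m S v u y) where
          private
            B = missed u S
            uniqB : Unique B
            uniqB = Unique-missed u uniq
            B⊆S : ∀ {x} → x ∈ B → x ∈ S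
            B⊆S = proj₁ ∘ ∈-missed⁻
            u≁B : ∀ {x} → x ∈ B → u ≁ x
            u≁B = proj₂ ∘ ∈-missed⁻ {S = S}
            y~B : ∀ {x} → x ∈ B → y ~ x
            y~B x∈B = Split.either σ (B⊆S x∈B) (u≁B x∈B)
            indepB : Independent B
            indepB p q = indep (B⊆S p) (B⊆S q)

          -- Otherwise `y`, `z` and a vertex of `B` missed by `w` form a triangle, with two vertices
          -- of `B` missed by `z` pendant at `y`. Swapping `τ` treats `w` likewise.
          y-misses-split : ∀ {w z} → Split 1 B v w z → y ≁ z
          y-misses-split {w} {z} τ with adj? y z
          ... | inj₂ y≁z = y≁z
          ... | inj₁ y~z with two-missed w uniqB (Split.u-misses τ) | two-missed z uniqB (Split.y-misses τ)
          ...   | p , _ , (p∈ , w≁p) , _ | q , q′ , (q∈ , z≁q) , (q′∈ , z≁q′) , q≢q′ =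
            contradiction q≢q′ (no-cricket y~z (y~B p∈) (Split.either τ p∈ w≁p) (y~B q∈) (y~B q′∈)
              z≁q z≁q′ (indepB p∈ q∈) (indepB p∈ q′∈) (indepB q∈ q′∈))

          -- Suppose `u ~ w`, and take `a` in `S` missed by `y`, so `u ~ a`. If `w ~ a`, the
          -- triangle `w u a` has two vertices of `B` missed by `z` pendant at `w`; if not,
          -- `w u a v p` is an induced path.
          u-misses-split : ∀ {w z} → Split 1 B v w z → u ≁ w
          u-misses-split {w} {z} τ with adj? u w
          ... | inj₂ u≁w = u≁w
          ... | inj₁ u~w
            with ∈-nonempty {xs = missed y S} (≤-<-trans z≤n (Split.y-misses σ))
               | two-missed w uniqB (Split.u-misses τ) | two-missed z uniqB (Split.y-misses τ)
          ...   | a , a∈ | p , _ , (p∈ , w≁p) , _ | q , q′ , (q∈ , z≁q) , (q′∈ , z≁q′) , q≢q′ =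
            contradiction (adj? w a) [ w~a-absurd , w≁a-absurd ]′
            where
            a∈S : a ∈ S
            a∈S = proj₁ (∈-missed⁻ {u = y} a∈)
            u~a : u ~ a
            u~a = Split.either (swap-split σ) a∈S (proj₂ (∈-missed⁻ {S = S} a∈))
            w~ : ∀ {x} → x ∈ B → z ≁ x → w ~ x
            w~ = Split.either (swap-split τ)
            a≁B : ∀ {x} → x ∈ B → a ≁ x
            a≁B = indep a∈S ∘ B⊆S
            w~a-absurd : w ~ a → ⊥
            w~a-absurd w~a = no-cricket (swap u~w) w~a u~a (w~ q∈ z≁q) (w~ q′∈ z≁q′)
              (u≁B q∈) (u≁B q′∈) (a≁B q∈) (a≁B q′∈) (indepB q∈ q′∈) q≢q′
            w≁a-absurd : w ≁ a → ⊥
            w≁a-absurd w≁a = no-P₅ (swap u~w) u~a (swap (v~S a∈S)) (v~S (B⊆S p∈))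
              w≁a (Split.u≁v τ) w≁p (Split.u≁v σ) (u≁B p∈) (a≁B p∈)

          -- For `q` in `B` missed by `z`, the path `u y q w z` is induced, since neither `u` nor
          -- `y` is adjacent to `w` or `z`.
          no-second-split : ∀ {w z} → ¬ Split 1 B v w z
          no-second-split {w} {z} τ with two-missed z uniqB (Split.y-misses τ)
          ... | q , _ , (q∈ , z≁q) , _ =
            no-P₅ (Split.u~y σ) (y~B q∈) (swap (Split.either (swap-split τ) q∈ z≁q)) (Split.u~y τ)
              (u≁B q∈) (u-misses-split τ) (u-misses-split (swap-split τ))
              (y-misses-split (swap-split τ)) (y-misses-split τ) (swap z≁q)

        -- The first split is taken with `m = suc k`, so that the part missed by `u` exceeds
        -- `suc k * 1` and splits again with `m = 1`. That threshold provides the two missed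
        -- vertices needed as pendants.
        no-large-independent : ¬ (suc k * suc k < length S)
        no-large-independent large with split uniq indep v~S (s≤s z≤n) large
        ... | u , y , σ with split (Unique-missed u uniq)
                               (λ x∈ x′∈ → indep (proj₁ (∈-missed⁻ x∈)) (proj₁ (∈-missed⁻ x′∈)))
                               (v~S ∘ proj₁ ∘ ∈-missed⁻ {u}) ≤-refl
                               (subst (_< length (missed u S)) (≡.sym (*-identityʳ (suc k))) (Split.u-misses σ))
        ...   | w , z , τ = no-second-split σ τ

      -- A `suc k`-colouring cuts the neighbourhood of `v` into independent classes, each of at most
      -- `suc k * suc k` vertices.
      degree-bound : ∀ v → length (nbrs v) ≤ suc k * (suc k * suc k)
      degree-bound v = ≮⇒≥ λ large →
        let i , _ , many = monochromatic (toℕ ∘ f) (suc k * suc k) (suc k) (nbrs v)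
                             (All.tabulate (λ {x} _ → Fin.toℕ<n (f x))) large
            colour? = λ x → toℕ (f x) ≟ i
            class⁻ = λ {x} → ∈-filter⁻ colour? {x} {nbrs v}
        in  no-large-independent
              (Unique-filter⁺ colour? (Unique-filter⁺ (λ x → adj G v x Bool.≟ true) (Unique-allFin n)))
              (λ x∈ y∈ → colour-class-independent toℕ∘f-proper
                (trans (proj₂ (class⁻ x∈)) (≡.sym (proj₂ (class⁻ y∈)))))
              (λ x∈ → proj₂ (∈-filter⁻ (λ x → adj G v x Bool.≟ true) {xs = allFin n} (proj₁ (class⁻ x∈))))
              many
        where
        f = proj₁ (proj₁ (proj₁ critical))
        toℕ∘f-proper : Proper G (toℕ ∘ f)
        toℕ∘f-proper u w u~w eq = proj₂ (proj₁ (proj₁ critical)) u w u~w (Fin.toℕ-injective eq)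

      -- The ball of radius 3 and the bound on the order.

      ball-closed : ∀ {v c d} → c ∈ ball 3 v → c ~ d → d ∈ ball 3 v
      ball-closed {v} {c} {d} c∈ c~d with DecMembership._∈?_ Fin._≟_ d (ball 3 v)
      ... | yes d∈ = d∈
      ... | no d∉ with ball-suc⁻ {2} {v} c∈
      ...   | _ , c∈2 , inj₁ refl = ball-nbr {2} c∈2 c~d
      ...   | b , b∈ , inj₂ b~c with ball-suc⁻ {1} {v} b∈
      ...     | _ , b∈1 , inj₁ refl = ball-nbr {2} (ball-nbr {1} b∈1 b~c) c~d
      ...     | a , a∈ , inj₂ a~b with ball-suc⁻ {0} {v} a∈
      ...       | _ , here refl , inj₁ refl = ball-nbr {2} (ball-nbr {1} (ball-nbr {0} (here refl) a~b) b~c) c~d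
      -- The walk `v a b c d` remains. Any chord would bring `d` within distance 3 of `v`, so with
      -- `d` outside the ball it is an induced path.
      ...       | _ , here refl , inj₂ v~a = contradiction
        (no-P₅ v~a a~b b~c c~d
          (unless λ v~b → ball-nbr {2} (ball-nbr {1} (ball-nbr {0} (here refl) v~b) b~c) c~d)
          (unless λ v~c → ball-nbr {2} (ball-mono {1} (ball-nbr {0} (here refl) v~c)) c~d)
          (unless λ v~d → ball-mono {2} (ball-mono {1} (ball-nbr {0} (here refl) v~d)))
          (unless λ a~c → ball-nbr {2} (ball-nbr {1} a∈1 a~c) c~d)
          (unless λ a~d → ball-mono {2} (ball-nbr {1} a∈1 a~d))
          (unless λ b~d → ball-nbr {2} b∈ b~d)) λ ()
        where
        a∈1 : a ∈ ball 1 v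
        a∈1 = ball-nbr {0} (here refl) v~a
        unless : ∀ {x y} → (x ~ y → d ∈ ball 3 v) → x ≁ y
        unless {x} {y} inside with adj? x y
        ... | inj₁ x~y = contradiction (inside x~y) d∉
        ... | inj₂ x≁y = x≁y

      -- A k-colouring of G − x on the ball and one of G − v off the ball glue to one of G.
      ball-spans : ∀ v x → ¬ x ∉ ball 3 v
      ball-spans v x x∉ with colouring-off x | colouring-off v
      ... | c , c-proper , c< , _ | d , d-proper , d< , _ = not-k-colourable glued glued-proper glued<
        where
        inside? : ∀ w → Dec (w ∈ ball 3 v)
        inside? w = DecMembership._∈?_ Fin._≟_ w (ball 3 v)

        glued : Fin n → ℕ
        glued w with inside? w
        ... | yes _ = c w
        ... | no _  = d w

        -- The exceptional colour `k` is avoided: `c` uses it only at `x`, outside the ball, and `d`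
        -- only at `v`, inside.
        glued< : ∀ w → glued w < k
        glued< w with inside? w
        ... | yes w∈ = c< w λ { refl → x∉ w∈ }
        ... | no w∉  = d< w λ { refl → w∉ (ball-mono {2} (ball-mono {1} (ball-mono {0} (here refl)))) }

        glued-proper : Proper G glued
        glued-proper u w u~w with inside? u | inside? w
        ... | yes _  | yes _  = c-proper u w u~w
        ... | yes u∈ | no w∉  = contradiction (ball-closed u∈ u~w) w∉
        ... | no u∉  | yes w∈ = contradiction (ball-closed w∈ (swap u~w)) u∉
        ... | no _   | no _   = d-proper u w u~w

      order-bound : n ≤ suc (suc k * (suc k * suc k)) ^ 3
      order-bound = ≮⇒≥ λ large →
        let v = fromℕ< (≤-<-trans z≤n large)
            x , x∉ = ∉-exists (ball 3 v) (≤-<-trans (length-ball-≤ degree-bound 3 v) large)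
        in  ball-spans v x x∉

-- Enumeration of all graphs of bounded order.

extend : ∀ {n} → Graph n → Vec Bool n → Graph (suc n)
extend {n} G row = record { adj = adj′ ; sym = sym′ ; irrefl = irrefl′ }
  where
  adj′ : Fin (suc n) → Fin (suc n) → Bool
  adj′ zero    zero    = false
  adj′ zero    (suc j) = lookup row j
  adj′ (suc i) zero    = lookup row i
  adj′ (suc i) (suc j) = adj G i j
  sym′ : ∀ i j → adj′ i j ≡ adj′ j i
  sym′ zero    zero    = refl
  sym′ zero    (suc j) = refl
  sym′ (suc i) zero    = refl
  sym′ (suc i) (suc j) = sym G i j
  irrefl′ : ∀ i → adj′ i i ≡ false
  irrefl′ zero    = refl
  irrefl′ (suc i) = irrefl G i

rows : ∀ n → List (Vec Bool n)
rows zero    = [] ∷ []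
rows (suc n) = cartesianProductWith _∷_ (true ∷ false ∷ []) (rows n)

∈-rows : ∀ {n} (row : Vec Bool n) → row ∈ rows n
∈-rows []          = here refl
∈-rows (true ∷ r)  = ∈-cartesianProductWith⁺ _∷_ {xs = true ∷ false ∷ []} (here refl) (∈-rows r)
∈-rows (false ∷ r) = ∈-cartesianProductWith⁺ _∷_ {xs = true ∷ false ∷ []} (there (here refl)) (∈-rows r)

graphs : ∀ n → List (Graph n)
graphs zero    = record { adj = λ () ; sym = λ () ; irrefl = λ () } ∷ []
graphs (suc n) = cartesianProductWith extend (graphs n) (rows n)

-- Vertex `zero` is split off and restored by `extend`. Pointwise agreement of adjacencies suffices,
-- as it makes the identity an isomorphism.
graphs-complete : ∀ {n} (G : Graph n) → ∃[ H ] H ∈ graphs n × (∀ u v → adj G u v ≡ adj H u v)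
graphs-complete {zero}  G = _ , here refl , λ ()
graphs-complete {suc n} G =
  let H , H∈ , agrees = graphs-complete {n} (delete G zero)
      row = tabulate (λ i → adj G zero (suc i))
  in  extend H row , ∈-cartesianProductWith⁺ extend H∈ (∈-rows row) , λ
        { zero    zero    → irrefl G zero
        ; zero    (suc j) → ≡.sym (Vec.lookup∘tabulate _ j)
        ; (suc i) zero    → trans (sym G (suc i) zero) (≡.sym (Vec.lookup∘tabulate _ i))
        ; (suc i) (suc j) → agrees i j
        }

bounded⇒finitely-many : ∀ {P : ∀ {n} → Graph n → Set} N → (∀ {n} (G : Graph n) → P G → n ≤ N) →
  FinitelyManyUpToIso P
bounded⇒finitely-many {P} N bound =
  concatMap (λ n → map (n ,_) (graphs n)) (upTo (suc N)) , λ {n} G PG →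
    let H , H∈ , agrees = graphs-complete G
    in  Any.concatMap⁺ (λ n → map (n ,_) (graphs n)) (lose (∈-upTo⁺ (s≤s (bound G PG)))
          (Any.map⁺ (lose H∈ (↔-id (Fin n) , agrees))))

theorem7 : (k : ℕ) → k ≥ 1 →
    FinitelyManyUpToIso (λ G → VertexCritical k G × (P₅ , cricket -Free) G)
theorem7 (suc k) _ = bounded⇒finitely-many _ λ G (critical , free) → Free.order-bound G free critical
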